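{- Let $J,A$ be sets. For all $\vec u:\mathsf{List}(J)$, all $\alpha:\mathbb{N}\to J$ and all $\mathfrak a:\mathcal{E}(\mathbb{N},J,A)$, $$\mathsf{exec}_{\mathcal{E}}(\mathfrak a,\ \vec u\cdot\alpha)=\mathsf{exec}_{\mathcal{B}}(\mathsf{norm}_{\vec u}(\mathfrak a),\ \alpha).$$ In particular, for $\vec u=[\,]$, $\mathsf{exec}_{\mathcal{E}}(\mathfrak a,\alpha)=\mathsf{exec}_{\mathcal{B}}(\mathsf{norm}_{[\,]}(\mathfrak a),\alpha)$ for every dialogue $\mathfrak a$.
   Context: Setting: constructive metatheory with function extensionality. $\mathsf{List}(J)$: finite lists; $[\,]$ the empty list; $j::\vec v$ has head $j$ and tail $\vec v$; $\vec u\cdot j$ is $\vec u$ with $j$ appended at the end. For $\vec u:\mathsf{List}(J)$ and $\alpha:\mathbb{N}\to J$, $\vec u\cdot\alpha:\mathbb{N}\to J$ is the sequence consisting of $\vec u$ followed by $\alpha$. $\mathsf{head}(\alpha)=\alpha(0)$ and $\mathsf{tail}(\alpha)(n)=\alpha(n+1)$. Escardó dialogues. For sets $I,J,A$, $\mathcal{E}(I,J,A)$ is the inductive set with constructors $\mathsf{ret}(a)$ for $a:A$, and $\mathsf{query}(i,\mathfrak a)$ for $i:I$ and $\mathfrak a:J\to\mathcal{E}(I,J,A)$. Execution against $\alpha:I\to J$: $\mathsf{exec}_{\mathcal{E}}(\mathsf{ret}(a),\alpha)=a$, $\mathsf{exec}_{\mathcal{E}}(\mathsf{query}(i,\mathfrak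 a),\alpha)=\mathsf{exec}_{\mathcal{E}}(\mathfrak a(\alpha(i)),\alpha)$. Brouwerian dialogues. For sets $J,A$, $\mathcal{B}(J,A)$ is the inductive set with constructors $\mathsf{spit}(a)$ for $a:A$, and $\mathsf{bite}(\mathbf a)$ for $\mathbf a:J\to\mathcal{B}(J,A)$. Execution against $\alpha:\mathbb{N}\to J$: $\mathsf{exec}_{\mathcal{B}}(\mathsf{spit}(a),\alpha)=a$, $\mathsf{exec}_{\mathcal{B}}(\mathsf{bite}(\mathbf a),\alpha)=\mathsf{exec}_{\mathcal{B}}(\mathbf a(\mathsf{head}(\alpha)),\mathsf{tail}(\alpha))$. Normalization. Two relations are defined by mutual induction: $\vec u\Vdash\mathfrak a\Downarrow\mathbf a$ (with $\vec u:\mathsf{List}(J)$, $\mathfrak a:\mathcal{E}(\mathbb{N},J,A)$, $\mathbf a:\mathcal{B}(J,A)$), and $\vec u\Vdash\langle i,\mathfrak a\rangle;\vec v\Downarrow\mathbf a$ (with $\vec u,\vec v:\mathsf{List}(J)$, $i:\mathbb{N}$, $\mathfrak a:J\to\mathcal{E}(\mathbb{N},J,A)$, $\mathbf a:\mathcal{B}(J,A)$), generated by the rules: 1. $\vec u\Vdash\mathsf{ret}(a)\Downarrow\mathsf{spit}(a)$. 2. If $\vec u\Vdash\langle i,\mathfrak a\rangle;\vec u\Downarrow\mathbf a$, then $\vec u\Vdash\mathsf{query}(i,\mathfrak a)\Downarrow\mathbf a$. 3. If $\vec u\Vdash\mathfrak a(j)\Downarrow\mathbf a$, then $\vec u\Vdash\langle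 0,\mathfrak a\rangle;(j::\vec v)\Downarrow\mathbf a$. 4. If $\vec u\Vdash\langle i,\mathfrak a\rangle;\vec v\Downarrow\mathbf a$, then $\vec u\Vdash\langle i+1,\mathfrak a\rangle;(j::\vec v)\Downarrow\mathbf a$. 5. If for all $j:J$, $\vec u\cdot j\Vdash\mathfrak a(j)\Downarrow\mathbf a(j)$, then $\vec u\Vdash\langle 0,\mathfrak a\rangle;[\,]\Downarrow\mathsf{bite}(\mathbf a)$. 6. If for all $j:J$, $\vec u\cdot j\Vdash\langle i,\mathfrak a\rangle;[\,]\Downarrow\mathbf a(j)$, then $\vec u\Vdash\langle i+1,\mathfrak a\rangle;[\,]\Downarrow\mathsf{bite}(\mathbf a)$. The first relation is functional: for each $\vec u,\mathfrak a$ there is a unique $\mathbf a$ with $\vec u\Vdash\mathfrak a\Downarrow\mathbf a$; this $\mathbf a$ is denoted $\mathsf{norm}_{\vec u}(\mathfrak a)$. -}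

module Defs where

open import Level using (Level; _⊔_)
open import Data.Nat.Base using (ℕ; zero; suc)
open import Data.List.Base using (List; []; _∷_; _∷ʳ_)
open import Data.Product using (∃; ∃!; _,_; proj₁; proj₂)
open import Function.Base using (_∘_)
open import Relation.Binary.PropositionalEquality using (_≡_; refl; cong)
open import Axiom.Extensionality.Propositional using (Extensionality)

private
  variable
    ℓi ℓj ℓa : Level
    I : Set ℓi
    J : Set ℓj
    A : Set ℓa

head : (ℕ → J) → J
head α = α zero

tail : (ℕ → J) → (ℕ → J)
tail α = α ∘ suc

infixr 5 _·_

_·_ : List J → (ℕ → J) → (ℕ → J)
([] · α) n = α n
((j ∷ u) · α) zero = j
((j ∷ u) · α) (suc n) = (u · α) n

data 𝓔 (I : Set ℓi) (J : Set ℓj) (A : Set ℓa) : Set (ℓi ⊔ ℓj ⊔ ℓa) where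
  ret   : A → 𝓔 I J A
  query : I → (J → 𝓔 I J A) → 𝓔 I J A

exec𝓔 : 𝓔 I J A → (I → J) → A
exec𝓔 (ret a) α = a
exec𝓔 (query i 𝔞) α = exec𝓔 (𝔞 (α i)) α

data 𝓑 (J : Set ℓj) (A : Set ℓa) : Set (ℓj ⊔ ℓa) where
  spit : A → 𝓑 J A
  bite : (J → 𝓑 J A) → 𝓑 J A

exec𝓑 : 𝓑 J A → (ℕ → J) → A
exec𝓑 (spit a) α = a
exec𝓑 (bite b) α = exec𝓑 (b (head α)) (tail α)

infix 4 _⊩_⇓_ _⊩⟨_,_⟩⨾_⇓_

mutual
  data _⊩_⇓_ {J : Set ℓj} {A : Set ℓa} :
       List J → 𝓔 ℕ J A → 𝓑 J A → Set (ℓj ⊔ ℓa) where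
    ⇓ret   : ∀ {u a} → u ⊩ ret a ⇓ spit a
    ⇓query : ∀ {u i 𝔞 b} → u ⊩⟨ i , 𝔞 ⟩⨾ u ⇓ b → u ⊩ query i 𝔞 ⇓ b

  data _⊩⟨_,_⟩⨾_⇓_ {J : Set ℓj} {A : Set ℓa} :
       List J → ℕ → (J → 𝓔 ℕ J A) → List J → 𝓑 J A → Set (ℓj ⊔ ℓa) where
    zero-∷  : ∀ {u 𝔞 j v b} → u ⊩ 𝔞 j ⇓ b → u ⊩⟨ zero , 𝔞 ⟩⨾ (j ∷ v) ⇓ b
    suc-∷   : ∀ {u i 𝔞 j v b} → u ⊩⟨ i , 𝔞 ⟩⨾ v ⇓ b → u ⊩⟨ suc i , 𝔞 ⟩⨾ (j ∷ v) ⇓ b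
    zero-[] : ∀ {u 𝔞 b} → (∀ j → (u ∷ʳ j) ⊩ 𝔞 j ⇓ b j) →
              u ⊩⟨ zero , 𝔞 ⟩⨾ [] ⇓ bite b
    suc-[]  : ∀ {u i 𝔞 b} → (∀ j → (u ∷ʳ j) ⊩⟨ i , 𝔞 ⟩⨾ [] ⇓ b j) →
              u ⊩⟨ suc i , 𝔞 ⟩⨾ [] ⇓ bite b

mutual
  ⇓-total : (u : List J) (𝔞 : 𝓔 ℕ J A) → ∃ λ b → u ⊩ 𝔞 ⇓ b
  ⇓-total u (ret a) = spit a , ⇓ret
  ⇓-total u (query i 𝔞) with ⨾⇓-total u i 𝔞 u
  ... | b , d = b , ⇓query d

  ⨾⇓-total : (u : List J) (i : ℕ) (𝔞 : J → 𝓔 ℕ J A) (v : List J) →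
             ∃ λ b → u ⊩⟨ i , 𝔞 ⟩⨾ v ⇓ b
  ⨾⇓-total u zero 𝔞 (j ∷ v) with ⇓-total u (𝔞 j)
  ... | b , d = b , zero-∷ d
  ⨾⇓-total u (suc i) 𝔞 (j ∷ v) with ⨾⇓-total u i 𝔞 v
  ... | b , d = b , suc-∷ d
  ⨾⇓-total u zero 𝔞 [] =
    bite (λ j → proj₁ (⇓-total (u ∷ʳ j) (𝔞 j))) ,
    zero-[] (λ j → proj₂ (⇓-total (u ∷ʳ j) (𝔞 j)))
  ⨾⇓-total u (suc i) 𝔞 [] =
    bite (λ j → proj₁ (⨾⇓-total (u ∷ʳ j) i 𝔞 [])) ,
    suc-[] (λ j → proj₂ (⨾⇓-total (u ∷ʳ j) i 𝔞 []))

module _ {ℓj ℓa} (funext : Extensionality ℓj (ℓj ⊔ ℓa)) {J : Set ℓj} {A : Set ℓa} where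

  mutual
    ⇓-unique : ∀ {u} {𝔞 : 𝓔 ℕ J A} {b c} → u ⊩ 𝔞 ⇓ b → u ⊩ 𝔞 ⇓ c → b ≡ c
    ⇓-unique ⇓ret ⇓ret = refl
    ⇓-unique (⇓query d) (⇓query e) = ⨾⇓-unique d e

    ⨾⇓-unique : ∀ {u i} {𝔞 : J → 𝓔 ℕ J A} {v b c} →
                u ⊩⟨ i , 𝔞 ⟩⨾ v ⇓ b → u ⊩⟨ i , 𝔞 ⟩⨾ v ⇓ c → b ≡ c
    ⨾⇓-unique (zero-∷ d) (zero-∷ e) = ⇓-unique d e
    ⨾⇓-unique (suc-∷ d) (suc-∷ e) = ⨾⇓-unique d e
    ⨾⇓-unique (zero-[] d) (zero-[] e) = cong bite (funext λ j → ⇓-unique (d j) (e j))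
    ⨾⇓-unique (suc-[] d) (suc-[] e) = cong bite (funext λ j → ⨾⇓-unique (d j) (e j))

  ⇓-functional : (u : List J) (𝔞 : 𝓔 ℕ J A) → ∃! _≡_ λ b → u ⊩ 𝔞 ⇓ b
  ⇓-functional u 𝔞 with ⇓-total u 𝔞
  ... | b , d = b , d , ⇓-unique d

  -- Function extensionality enters only through the uniqueness half of
  -- ⇓-functional; the dialogue that norm computes does not depend on it.
  norm : List J → 𝓔 ℕ J A → 𝓑 J A
  norm u 𝔞 = proj₁ (⇓-functional u 𝔞)

{-# OPTIONS --safe #-}

-- By induction on derivations.  The invariant for the auxiliary judgement
-- u ⊩⟨ i , 𝔞 ⟩⨾ v ⇓ b is that the pending query i is answered from what remains
-- of the input, i.e. by (v · α) i, while later queries see the whole input u · α.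
-- A bite only moves the head of α to the end of u, which leaves u · α unchanged.

module Submission where

open import Defs
open import Level using (Level; _⊔_)
open import Data.Nat.Base using (ℕ; zero; suc)
open import Data.List.Base using (List; []; _∷_; _∷ʳ_)
open import Data.Product.Base using (_×_; _,_; proj₁; proj₂)
open import Relation.Binary.PropositionalEquality using (_≡_; _≗_; refl; sym; trans)
open import Axiom.Extensionality.Propositional using (Extensionality)

private
  variable
    ℓi ℓj ℓa : Level
    I : Set ℓi
    J : Set ℓj
    A : Set ℓa

∷ʳ-head-·-tail : (u : List J) (α : ℕ → J) → (u ∷ʳ head α) · tail α ≗ u · α
∷ʳ-head-·-tail []      α zero    = refl
∷ʳ-head-·-tail []      α (suc n) = refl
∷ʳ-head-·-tail (j ∷ u) α zero    = refl
∷ʳ-head-·-tail (j ∷ u) α (suc n) = ∷ʳ-head-·-tail u α n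

-- Each `query` reads a single value of the sequence, so pointwise agreement suffices.
exec𝓔-cong : (𝔞 : 𝓔 I J A) {α β : I → J} → α ≗ β → exec𝓔 𝔞 α ≡ exec𝓔 𝔞 β
exec𝓔-cong (ret a)     α≗β = refl
exec𝓔-cong (query i 𝔞) {α} {β} α≗β rewrite α≗β i = exec𝓔-cong (𝔞 (β i)) α≗β

exec𝓔-∷ʳ : (𝔞 : 𝓔 ℕ J A) (u : List J) (α : ℕ → J) →
           exec𝓔 𝔞 (u · α) ≡ exec𝓔 𝔞 ((u ∷ʳ head α) · tail α)
exec𝓔-∷ʳ 𝔞 u α = sym (exec𝓔-cong 𝔞 (∷ʳ-head-·-tail u α))

mutual
  ⇓-sound : ∀ {u} {𝔞 : 𝓔 ℕ J A} {b} → u ⊩ 𝔞 ⇓ b →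
            (α : ℕ → J) → exec𝓔 𝔞 (u · α) ≡ exec𝓑 b α
  ⇓-sound ⇓ret       α = refl
  -- Here `v` is `u`, so the auxiliary invariant is `exec𝓔` unfolded once at the query.
  ⇓-sound (⇓query d) α = ⨾⇓-sound d α

  ⨾⇓-sound : ∀ {u i} {𝔞 : J → 𝓔 ℕ J A} {v b} → u ⊩⟨ i , 𝔞 ⟩⨾ v ⇓ b →
             (α : ℕ → J) → exec𝓔 (𝔞 ((v · α) i)) (u · α) ≡ exec𝓑 b α
  ⨾⇓-sound (zero-∷ d) α = ⇓-sound d α
  ⨾⇓-sound (suc-∷ d)  α = ⨾⇓-sound d α
  ⨾⇓-sound {u = u} {𝔞 = 𝔞} (zero-[] d) α =
    trans (exec𝓔-∷ʳ (𝔞 (head α)) u α) (⇓-sound (d (head α)) (tail α))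
  -- The pending answer `α (suc i)` is `([] · tail α) i` by computation, as the premise at `head α`
  -- expects.
  ⨾⇓-sound {u = u} {i = suc i} {𝔞 = 𝔞} (suc-[] d) α =
    trans (exec𝓔-∷ʳ (𝔞 (tail α i)) u α) (⨾⇓-sound (d (head α)) (tail α))

lemma3p4 : {ℓj ℓa : Level} (funext : Extensionality ℓj (ℓj ⊔ ℓa)) (J : Set ℓj) (A : Set ℓa) →
    ((u : List J) (α : ℕ → J) (𝔞 : 𝓔 ℕ J A) →
    exec𝓔 𝔞 (u · α) ≡ exec𝓑 (norm funext u 𝔞) α)
    ×
    ((α : ℕ → J) (𝔞 : 𝓔 ℕ J A) →
    exec𝓔 𝔞 α ≡ exec𝓑 (norm funext [] 𝔞) α)
lemma3p4 funext J A = exec-norm , exec-norm []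
  where
  exec-norm : (u : List J) (α : ℕ → J) (𝔞 : 𝓔 ℕ J A) →
              exec𝓔 𝔞 (u · α) ≡ exec𝓑 (norm funext u 𝔞) α
  -- The derivation paired with the dialogue that `norm` projects out.
  exec-norm u α 𝔞 = ⇓-sound (proj₁ (proj₂ (⇓-functional funext u 𝔞))) α
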